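{- Let $Q:V_8\to\mathbb{F}_2$ be the quadratic form $Q(x)=x_1x_8+x_2x_7+x_3x_6+x_4x_5+\sum_{i=1}^8 x_i$, where $x=\sum_i x_ie_i$. Then the quadric $\mathcal{Q}=\{p\in\operatorname{PG}(7,2): Q(p)=0\}$ is a non-degenerate hyperbolic quadric $\mathcal{H}_7$ (it has $135$ points), and $\mathcal{Q}=\omega_2\cup\omega_4$.
   Context: Work over $\mathbb{F}_2$. Let $V_8=V(8,2)$ with basis $e_1,\dots,e_8$, and put $V_a=\langle e_1,e_8\rangle$, $V_b=\langle e_2,e_7\rangle$, $V_c=\langle e_3,e_6\rangle$, $V_d=\langle e_4,e_5\rangle$, so $V_8=V_a\oplus V_b\oplus V_c\oplus V_d$. Points of $\operatorname{PG}(7,2)=\mathbb{P}V_8$ are identified with nonzero vectors. The line-weight of a point $x=x_a+x_b+x_c+x_d$ ($x_h\in V_h$) is the number of $h\in\{a,b,c,d\}$ with $x_h\neq0$, and $\omega_r$ ($r=1,2,3,4$) is the set of points of line-weight $r$ (so $|\omega_1|=12,|\omega_2|=54,|\omega_3|=108,|\omega_4|=81$). The form $Q$ polarizes to the alternating form $B(x,y)=\sum(x_iy_{9-i})$ over pairs $\{1,8\},\{2,7\},\{3,6\},\{4,5\}$, for which $V_a,V_b,V_c,V_d$ are pairwise orthogonal hyperbolic planes, and $Q$ takes the value $1$ on every point of $\omega_1$ (it is the unique quadratic form with these two properties). -}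

module Defs where

open import Data.Bool using (Bool; true; false; _∧_; _∨_; _xor_; not; if_then_else_)
open import Data.Nat using (ℕ; zero; suc; _+_)
open import Data.Fin using (Fin)
open import Data.Vec using (Vec; []; _∷_; lookup; tabulate; foldr; zipWith; map)
open import Data.List as L using (List; filter; length)
open import Data.Product using (Σ; _×_)
open import Relation.Binary.PropositionalEquality using (_≡_)
open import Relation.Nullary using (¬_)
open import Relation.Nullary.Decidable using (Dec)
open import Data.Bool.Properties using (_≟_)

-- Over F₂ = Bool: addition is xor, multiplication is ∧.
-- A vector x = Σ xᵢ eᵢ of V₈ = V(8,2) is written  x₁ ∷ x₂ ∷ … ∷ x₈ ∷ [].
V₈ : Set
V₈ = Vec Bool 8

𝟎 : V₈
𝟎 = tabulate (λ _ → false)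

-- a point of PG(7,2) = a nonzero vector of V₈
IsPoint : V₈ → Set
IsPoint x = ¬ (x ≡ 𝟎)

allVecs : (n : ℕ) → List (Vec Bool n)
allVecs zero = [] L.∷ L.[]
allVecs (suc n) = L.map (false ∷_) (allVecs n) L.++ L.map (true ∷_) (allVecs n)

Q : V₈ → Bool
Q (x₁ ∷ x₂ ∷ x₃ ∷ x₄ ∷ x₅ ∷ x₆ ∷ x₇ ∷ x₈ ∷ []) =
  (x₁ ∧ x₈) xor (x₂ ∧ x₇) xor (x₃ ∧ x₆) xor (x₄ ∧ x₅) xor
  (x₁ xor x₂ xor x₃ xor x₄ xor x₅ xor x₆ xor x₇ xor x₈)

-- The canonical hyperbolic form Q⁺(x) = x₁x₈ + x₂x₇ + x₃x₆ + x₄x₅,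
-- whose zero set is the hyperbolic quadric H₇ in canonical position.
Qhyp : V₈ → Bool
Qhyp (x₁ ∷ x₂ ∷ x₃ ∷ x₄ ∷ x₅ ∷ x₆ ∷ x₇ ∷ x₈ ∷ []) =
  (x₁ ∧ x₈) xor (x₂ ∧ x₇) xor (x₃ ∧ x₆) xor (x₄ ∧ x₅)

Mat : Set
Mat = Vec (Vec Bool 8) 8

dot : {n : ℕ} → Vec Bool n → Vec Bool n → Bool
dot u v = foldr _ _xor_ false (zipWith _∧_ u v)

_·_ : Mat → V₈ → V₈
M · x = map (λ row → dot row x) M

Invertible : Mat → Set
Invertible M = Σ Mat (λ N → ((x : V₈) → N · (M · x) ≡ x) × ((x : V₈) → M · (N · x) ≡ x))

-- A quadratic form q on V₈ is (the form of) a non-degenerate hyperbolic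
-- quadric H₇ of PG(7,2) iff it is equivalent under GL(8,2) to the canonical
-- hyperbolic form:  q(Mx) = x₁x₈ + x₂x₇ + x₃x₆ + x₄x₅  for some invertible M.
IsHyperbolicQuadric : (V₈ → Bool) → Set
IsHyperbolicQuadric q = Σ Mat (λ M → Invertible M × ((x : V₈) → q (M · x) ≡ Qhyp x))

nonzero? : V₈ → Bool
nonzero? x = Data.Vec.foldr _ _∨_ false x

numZeros : (V₈ → Bool) → ℕ
numZeros q = length (filter (λ x → (nonzero? x ∧ not (q x)) ≟ true) (allVecs 8))

-- line-weight: number of h ∈ {a,b,c,d} with x_h ≠ 0, where
-- V_a = ⟨e₁,e₈⟩, V_b = ⟨e₂,e₇⟩, V_c = ⟨e₃,e₆⟩, V_d = ⟨e₄,e₅⟩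
b2n : Bool → ℕ
b2n true = 1
b2n false = 0

lineWeight : V₈ → ℕ
lineWeight (x₁ ∷ x₂ ∷ x₃ ∷ x₄ ∷ x₅ ∷ x₆ ∷ x₇ ∷ x₈ ∷ []) =
  b2n (x₁ ∨ x₈) + b2n (x₂ ∨ x₇) + b2n (x₃ ∨ x₆) + b2n (x₄ ∨ x₅)

ω : ℕ → V₈ → Set
ω r x = IsPoint x × lineWeight x ≡ r

-- Each plane carries the form x y + x + y, which is 1 on every nonzero vector;
-- hence Q is the parity of the line-weight.  This form is elliptic, and the
-- orthogonal sum of two elliptic planes is the sum of two hyperbolic ones:
-- if e, f are the basis vectors of a plane and g = e + f, then (e,e), (e,f) and
-- (f,g), (g,g) are orthogonal hyperbolic pairs of singular vectors.  Doing this in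
-- V_a ⊕ V_b and in V_c ⊕ V_d gives the change of basis.  What remains is finite
-- and is decided by enumerating the 256 vectors.
{-# OPTIONS --safe #-}
module Submission where

open import Defs
open import Data.Bool using (Bool; true; false)
open import Data.Bool.Properties using (_≟_)
open import Data.Nat using (ℕ; zero; suc)
import Data.Nat.Properties as ℕ
open import Data.Product using (_×_; _,_)
open import Data.Sum using (_⊎_)
open import Data.Vec using (Vec; []; _∷_)
open import Data.Vec.Properties using (≡-dec)
open import Function.Bundles using (_⇔_; mk⇔)
open import Level using (Level)
open import Relation.Binary.Definitions using (DecidableEquality)
open import Relation.Binary.PropositionalEquality using (_≡_; refl)
open import Relation.Nullary.Decidable
  using (Dec; map′; ¬?; _×-dec_; _⊎-dec_; _→-dec_; from-yes)
open import Relation.Unary using (Pred; Decidable)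

private
  variable
    ℓ : Level
    n : ℕ

-- Splitting on the first bit gives two shorter vectors to check; at length 8 this runs through all
-- 256 cases.
∀Vec? : {P : Pred (Vec Bool n) ℓ} → Decidable P → Dec (∀ x → P x)
∀Vec? {n = zero} P? = map′ (λ { p [] → p }) (λ f → f []) (P? [])
∀Vec? {n = suc n} P? =
  map′ (λ { (f , t) (false ∷ x) → f x ; (f , t) (true ∷ x) → t x })
       (λ f → (λ x → f (false ∷ x)) , (λ x → f (true ∷ x)))
       (∀Vec? (λ x → P? (false ∷ x)) ×-dec ∀Vec? (λ x → P? (true ∷ x)))

_≟V_ : DecidableEquality (Vec Bool n)
_≟V_ = ≡-dec _≟_

IsPoint? : Decidable IsPoint
IsPoint? x = ¬? (x ≟V 𝟎)

ω? : ∀ r → Decidable (ω r)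
ω? r x = IsPoint? x ×-dec lineWeight x ℕ.≟ r

private
  pattern I = true
  pattern O = false

-- Columns 1, 8 and 2, 7 are the pairs (e,e), (e,f) and (f,g), (g,g) in V_a ⊕ V_b;
-- columns 3, 6 and 4, 5 are the same pairs in V_c ⊕ V_d.
hyperbolicBasis : Mat
hyperbolicBasis =
  (I ∷ O ∷ O ∷ O ∷ O ∷ O ∷ I ∷ I ∷ []) ∷
  (I ∷ I ∷ O ∷ O ∷ O ∷ O ∷ I ∷ O ∷ []) ∷
  (O ∷ O ∷ I ∷ O ∷ I ∷ I ∷ O ∷ O ∷ []) ∷
  (O ∷ O ∷ I ∷ I ∷ I ∷ O ∷ O ∷ O ∷ []) ∷
  (O ∷ O ∷ O ∷ I ∷ I ∷ I ∷ O ∷ O ∷ []) ∷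
  (O ∷ O ∷ O ∷ I ∷ I ∷ O ∷ O ∷ O ∷ []) ∷
  (O ∷ I ∷ O ∷ O ∷ O ∷ O ∷ I ∷ I ∷ []) ∷
  (O ∷ I ∷ O ∷ O ∷ O ∷ O ∷ I ∷ O ∷ []) ∷ []

-- The coordinate of y along a basis vector is B(y , v), with v its hyperbolic partner.
hyperbolicCoordinates : Mat
hyperbolicCoordinates =
  (O ∷ I ∷ O ∷ O ∷ O ∷ O ∷ O ∷ I ∷ []) ∷
  (I ∷ I ∷ O ∷ O ∷ O ∷ O ∷ I ∷ I ∷ []) ∷
  (O ∷ O ∷ O ∷ I ∷ O ∷ I ∷ O ∷ O ∷ []) ∷
  (O ∷ O ∷ I ∷ I ∷ I ∷ I ∷ O ∷ O ∷ []) ∷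
  (O ∷ O ∷ I ∷ I ∷ I ∷ O ∷ O ∷ O ∷ []) ∷
  (O ∷ O ∷ O ∷ O ∷ I ∷ I ∷ O ∷ O ∷ []) ∷
  (I ∷ I ∷ O ∷ O ∷ O ∷ O ∷ I ∷ O ∷ []) ∷
  (O ∷ O ∷ O ∷ O ∷ O ∷ O ∷ I ∷ I ∷ []) ∷ []

hyperbolicBasis-invertible : Invertible hyperbolicBasis
hyperbolicBasis-invertible =
  hyperbolicCoordinates ,
  from-yes (∀Vec? λ x → (hyperbolicCoordinates · (hyperbolicBasis · x)) ≟V x) ,
  from-yes (∀Vec? λ x → (hyperbolicBasis · (hyperbolicCoordinates · x)) ≟V x)

Q-isHyperbolic : IsHyperbolicQuadric Q
Q-isHyperbolic =
  hyperbolicBasis , hyperbolicBasis-invertible ,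
  -- The columns are singular for `Q`, and only columns i and 9 - i have polar product 1.
  from-yes (∀Vec? λ x → Q (hyperbolicBasis · x) ≟ Qhyp x)

-- A point has line-weight 1 to 4, so even parity leaves only 2 and 4.
zero⇒ω₂∪ω₄ : ∀ x → IsPoint x × Q x ≡ false → ω 2 x ⊎ ω 4 x
zero⇒ω₂∪ω₄ =
  from-yes (∀Vec? λ x → (IsPoint? x ×-dec Q x ≟ false) →-dec (ω? 2 x ⊎-dec ω? 4 x))

ω₂∪ω₄⇒zero : ∀ x → ω 2 x ⊎ ω 4 x → IsPoint x × Q x ≡ false
ω₂∪ω₄⇒zero =
  from-yes (∀Vec? λ x → (ω? 2 x ⊎-dec ω? 4 x) →-dec (IsPoint? x ×-dec Q x ≟ false))

theorem1 : IsHyperbolicQuadric Q × numZeros Q ≡ 135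
    × ((x : V₈) → (IsPoint x × Q x ≡ false) ⇔ (ω 2 x ⊎ ω 4 x))
-- `refl` evaluates the count, 135 = 54 + 81 by line-weights 2 and 4.
theorem1 = Q-isHyperbolic , refl , λ x → mk⇔ (zero⇒ω₂∪ω₄ x) (ω₂∪ω₄⇒zero x)
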